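{- There is an absolute constant $c>0$ such that for all integers $k\ge1$, $n\ge3k$, $w\ge1$: if there exists a length-$n$ width-$w$ read-once branching program over alphabet $\{0,1\}^k$ computing $\mathsf{ApproxCount}_{k\text{ -parallel}}[n,n/3]$, then $w\ge n^{ck}$.
   Context: A length-$n$ read-once branching program (ROBP) over a finite alphabet $\Sigma$ is a directed layered multigraph with layers $V_0,\dots,V_n$, $V_0=\{v_{\mathrm{start}}\}$; for $0\le i\le n-1$ each vertex of $V_i$ has $|\Sigma|$ outgoing edges into $V_{i+1}$ labeled by distinct elements of $\Sigma$; vertices of $V_n$ are labeled with outputs; every vertex is reachable by some input. An input follows from $v_{\mathrm{start}}$ the edges labeled $x_1,\dots,x_n$ and the program outputs the label of the final vertex. Width is $\max_i|V_i|$. $\mathsf{ApproxCount}_{k\text{ -parallel}}[n,\Delta]$: on input $x=(x_1,\dots,x_n)\in(\{0,1\}^k)^n$ output reals $(\hat S_1,\dots,\hat S_k)$ with $|\hat S_j-\#\{i\in[n]:(x_i)_j=1\}|\le\Delta$ for all $j\in[k]$; a program computes it if its output is valid on every input.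
   Formalization: The outputs labelling the final vertices of the branching program are rational numbers rather than real numbers. -}

module Defs where

open import Data.Nat using (ℕ; zero; suc; _+_; _≤_)
open import Data.Bool using (Bool; true; false; if_then_else_)
open import Data.Fin using (Fin; inject₁; fromℕ)
import Data.Fin as Fin
open import Data.Vec using (Vec; lookup)
open import Data.Integer using (+_)
open import Data.Product using (Σ; ∃; _×_)
open import Data.Rational using (ℚ; _-_; ∣_∣) renaming (_≤_ to _≤ℚ_; _/_ to _/ℚ_)
open import Relation.Binary.PropositionalEquality using (_≡_; subst; sym)
open import Function using (_∘_)

Sym : ℕ → Set
Sym k = Vec Bool k

Input : ℕ → ℕ → Set
Input k m = Fin m → Sym k

-- A length-n ROBP over alphabet {0,1}^k, with outputs in ℚ^k.
-- Layer V_i is Fin (size i) (only layers i ≤ n matter);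
-- step i v a is the endpoint of the edge out of v ∈ V_i labelled a
-- (so each vertex has exactly one outgoing edge per symbol: a multigraph).
record ROBP (n k : ℕ) : Set where
  field
    size  : ℕ → ℕ
    size0 : size 0 ≡ 1
    step  : (i : ℕ) → Fin (size i) → Sym k → Fin (size (suc i))
    out   : Fin (size n) → Vec ℚ k

  start : Fin (size 0)
  start = subst Fin (sym size0) Fin.zero

  run : (i : ℕ) → Input k i → Fin (size i)
  run zero    x = start
  run (suc i) x = step i (run i (x ∘ inject₁)) (x (fromℕ i))

  Reachable : Set
  Reachable = (i : ℕ) → i ≤ n → (v : Fin (size i)) → ∃ λ (x : Input k i) → run i x ≡ v

  HasWidth : ℕ → Set
  HasWidth w = ((i : ℕ) → i ≤ n → size i ≤ w) × (Σ ℕ λ i → i ≤ n × size i ≡ w)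

  eval : Input k n → Vec ℚ k
  eval x = out (run n x)

count : {k m : ℕ} → Input k m → Fin k → ℕ
count {m = zero}  x j = 0
count {m = suc m} x j = (if lookup (x (fromℕ m)) j then 1 else 0) + count (x ∘ inject₁) j

ComputesApproxCount : {n k : ℕ} → ROBP n k → Set
ComputesApproxCount {n} {k} P =
  (x : Input k n) (j : Fin k) →
    ∣ lookup (ROBP.eval P x) j - (+ count x j) /ℚ 1 ∣ ≤ℚ (+ n) /ℚ 3

{-# OPTIONS --safe #-}

-- Adversary argument.  Fix q with 12 q ≤ n and run, for every s ∈ [0,q)^k, one input through the
-- program, keeping the invariant that for each coordinate j the vertex v(s) it occupies is also
-- reached by an input with at most s_j ones in coordinate j.  At each layer let
-- μ_j(c) = min { t_j : v(t) = c }; the next letter for s has j-th bit 1 iff μ_j(v(s)) ≠ s_j.  The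
-- invariant survives: a bit 1 means μ_j < s_j, and the input for a minimising t reaches the same vertex.
-- Correctness bounds the number of ones fed in coordinate j by s_j + 2n/3, so at least a quarter of all
-- bits fed are 0.  But a bit 0 means s_j = μ_j(v(s)), and with at most w vertices this is rare:
--   Σ_s q^#{j : s_j = μ_j(v(s))} ≤ Σ_c Π_j Σ_{a<q} q^[a = μ_j(c)] ≤ w (2q)^k.
-- With q = A^8 this yields A^k ≤ 8 w 2^k, so b^k ≤ w for A = 16 b; take b of order n^(1/8).  For bounded n
-- the hypothesis 3k ≤ n bounds k as well, and w ≥ 2 suffices.

module Submission where

open import Defs
open import Algebra.Properties.CommutativeSemigroup using (interchange)
open import Data.Nat using (ℕ; zero; suc; _+_; _≤_; _<_; _>_; _*_; _^_; _≟_; _≤?_; s≤s; z≤n; >-nonZero)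
open import Data.Nat.Properties
open import Data.Nat.ListAction using (sum)
open import Data.Nat.ListAction.Properties using (sum-++)
open import Data.Nat.Tactic.RingSolver using (solve-∀)
import Data.Integer as ℤ
import Data.Integer.Properties as ℤ
open import Data.Rational as ℚ using (ℚ; toℚᵘ; _-_; ∣_∣) renaming (_≤_ to _≤ℚ_; _/_ to _/ℚ_)
import Data.Rational.Properties as ℚ
open import Data.Rational.Solver using (module +-*-Solver)
open import Data.Rational.Unnormalised as ℚᵘ using (mkℚᵘ; *≤*)
import Data.Rational.Unnormalised.Properties as ℚᵘ
open import Data.Bool using (Bool; true; false; not; if_then_else_)
open import Data.Fin as Fin using (Fin; inject₁; fromℕ)
import Data.Fin.Properties as Fin
open import Data.List using (List; []; _∷_; _++_; map; length; downFrom; cartesianProductWith; allFin; filter)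
open import Data.List.Properties using (map-++; map-∘; length-downFrom; length-tabulate)
open import Data.List.Extrema.Nat using (argmin; argmin-sel; f[argmin]≤f[xs])
open import Data.List.Membership.Propositional using (_∈_)
open import Data.List.Membership.Propositional.Properties
  using (∈-allFin; ∈-filter⁺; ∈-filter⁻; ∈-downFrom⁻; ∈-cartesianProductWith⁻)
open import Data.List.Relation.Unary.All as All using ()
open import Data.List.Relation.Unary.Any using (here; there)
open import Data.Vec as Vec using (Vec; []; _∷_; lookup; zipWith; tabulate; replicate)
open import Data.Vec.Properties using (lookup-zipWith; lookup∘tabulate; lookup-replicate)
open import Data.Product using (Σ; ∃; _×_; _,_)
open import Data.Sum using (inj₁; inj₂)
open import Function using (_∘_; id)
open import Relation.Nullary using (⌊_⌋; yes; no; contradiction)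
open import Relation.Binary.PropositionalEquality

private variable
  A B C : Set
  k n : ℕ

-- From rational error bounds to an inequality between natural numbers.

/-toℚᵘ : ∀ m d → toℚᵘ ((ℤ.+ m) /ℚ suc d) ℚᵘ.≃ mkℚᵘ (ℤ.+ m) d
/-toℚᵘ m d = ℚ.toℚᵘ-fromℚᵘ (mkℚᵘ (ℤ.+ m) d)

p≤∣p∣ : ∀ p → p ≤ℚ ∣ p ∣
p≤∣p∣ p@(ℚ.mkℚ (ℤ.+ _) _ _)      = ℚ.≤-refl
p≤∣p∣ p@(ℚ.mkℚ (ℤ.-[1+ _ ]) _ _) = ℚ.*≤* ℤ.-≤+

-- Triangle inequality: `b - a` equals `(o - a) - (o - b)`, and each of the two terms contributes at
-- most `r`.
close⇒≤ : ∀ (o a b r : ℚ) → ∣ o - a ∣ ≤ℚ r → ∣ o - b ∣ ≤ℚ r → b ≤ℚ a ℚ.+ (r ℚ.+ r)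
close⇒≤ o a b r oa ob = begin
  b                                    ≡⟨ solve 3 (λ o a b → b := a :+ ((o :- a) :+ :- (o :- b))) refl o a b ⟩
  a ℚ.+ ((o - a) ℚ.+ ℚ.- (o - b))      ≤⟨ ℚ.+-monoʳ-≤ a (ℚ.+-mono-≤ (ℚ.≤-trans (p≤∣p∣ _) oa) (ℚ.≤-trans (p≤∣p∣ _) -ob)) ⟩
  a ℚ.+ (r ℚ.+ r)                      ∎
  where
  -ob : ∣ ℚ.- (o - b) ∣ ≤ℚ r
  -ob = subst (_≤ℚ r) (sym (ℚ.∣-p∣≡∣p∣ (o - b))) ob
  open ℚ.≤-Reasoning
  open +-*-Solver

close⇒3*≤ : ∀ (o : ℚ) (n a b : ℕ) →
            ∣ o - (ℤ.+ a) /ℚ 1 ∣ ≤ℚ (ℤ.+ n) /ℚ 3 → ∣ o - (ℤ.+ b) /ℚ 1 ∣ ≤ℚ (ℤ.+ n) /ℚ 3 →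
            3 * b ≤ 3 * a + 2 * n
close⇒3*≤ o n a b oa ob = clear-denominators gapᵘ
  where
  gapᵘ : mkℚᵘ (ℤ.+ b) 0 ℚᵘ.≤ mkℚᵘ (ℤ.+ a) 0 ℚᵘ.+ (mkℚᵘ (ℤ.+ n) 2 ℚᵘ.+ mkℚᵘ (ℤ.+ n) 2)
  gapᵘ = begin
    mkℚᵘ (ℤ.+ b) 0 ≃⟨ /-toℚᵘ b 0 ⟨
    toℚᵘ ((ℤ.+ b) /ℚ 1) ≤⟨ ℚ.toℚᵘ-mono-≤ (close⇒≤ o ((ℤ.+ a) /ℚ 1) ((ℤ.+ b) /ℚ 1) ((ℤ.+ n) /ℚ 3) oa ob) ⟩
    toℚᵘ ((ℤ.+ a) /ℚ 1 ℚ.+ ((ℤ.+ n) /ℚ 3 ℚ.+ (ℤ.+ n) /ℚ 3)) ≃⟨ ℚ.toℚᵘ-homo-+ ((ℤ.+ a) /ℚ 1) _ ⟩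
    toℚᵘ ((ℤ.+ a) /ℚ 1) ℚᵘ.+ toℚᵘ ((ℤ.+ n) /ℚ 3 ℚ.+ (ℤ.+ n) /ℚ 3)
      ≃⟨ ℚᵘ.+-cong (/-toℚᵘ a 0) (ℚᵘ.≃-trans (ℚ.toℚᵘ-homo-+ ((ℤ.+ n) /ℚ 3) _) (ℚᵘ.+-cong (/-toℚᵘ n 2) (/-toℚᵘ n 2))) ⟩
    mkℚᵘ (ℤ.+ a) 0 ℚᵘ.+ (mkℚᵘ (ℤ.+ n) 2 ℚᵘ.+ mkℚᵘ (ℤ.+ n) 2) ∎
    where open ℚᵘ.≤-Reasoning

  clear-denominators : mkℚᵘ (ℤ.+ b) 0 ℚᵘ.≤ mkℚᵘ (ℤ.+ a) 0 ℚᵘ.+ (mkℚᵘ (ℤ.+ n) 2 ℚᵘ.+ mkℚᵘ (ℤ.+ n) 2) → 3 * b ≤ 3 * a + 2 * n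
  -- The unnormalised sum of two thirds has denominator 9, so cross-multiplication leaves a surplus
  -- factor 3 on both sides, which is cancelled.
  clear-denominators (*≤* p) = *-cancelˡ-≤ 3 (subst₂ _≤_ (lhs b) (rhs a n) (ℤ.drop‿+≤+ (subst₂ ℤ._≤_ (sym (ℤ.pos-* b 9)) num p)))
    where
    lhs : ∀ b → b * 9 ≡ 3 * (3 * b)
    lhs = solve-∀
    rhs : ∀ a n → (a * 9 + (n * 3 + n * 3) * 1) * 1 ≡ 3 * (3 * a + 2 * n)
    rhs = solve-∀
    num : (ℤ.+ a ℤ.* ℤ.+ 9 ℤ.+ (ℤ.+ n ℤ.* ℤ.+ 3 ℤ.+ ℤ.+ n ℤ.* ℤ.+ 3) ℤ.* ℤ.+ 1) ℤ.* ℤ.+ 1 ≡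
          ℤ.+ ((a * 9 + (n * 3 + n * 3) * 1) * 1)
    num rewrite sym (ℤ.pos-* a 9) | sym (ℤ.pos-* n 3) | sym (ℤ.pos-* (n * 3 + n * 3) 1)
              | sym (ℤ.pos-* (a * 9 + (n * 3 + n * 3) * 1) 1) = refl

-- Finite sums over lists.

∑ : List A → (A → ℕ) → ℕ
∑ xs f = sum (map f xs)

∑-mono : ∀ (xs : List A) {f g : A → ℕ} → (∀ {x} → x ∈ xs → f x ≤ g x) → ∑ xs f ≤ ∑ xs g
∑-mono []       h = z≤n
∑-mono (x ∷ xs) h = +-mono-≤ (h (here refl)) (∑-mono xs (h ∘ there))

∑-cong : ∀ (xs : List A) {f g : A → ℕ} → (∀ x → f x ≡ g x) → ∑ xs f ≡ ∑ xs g
∑-cong []       h = refl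
∑-cong (x ∷ xs) h = cong₂ _+_ (h x) (∑-cong xs h)

∑-+ : ∀ (xs : List A) (f g : A → ℕ) → ∑ xs (λ x → f x + g x) ≡ ∑ xs f + ∑ xs g
∑-+ []       f g = refl
∑-+ (x ∷ xs) f g = trans (cong (f x + g x +_) (∑-+ xs f g)) (interchange +-commutativeSemigroup (f x) (g x) _ _)

∑-*ˡ : ∀ (xs : List A) c (f : A → ℕ) → ∑ xs (λ x → c * f x) ≡ c * ∑ xs f
∑-*ˡ []       c f = sym (*-zeroʳ c)
∑-*ˡ (x ∷ xs) c f = trans (cong (c * f x +_) (∑-*ˡ xs c f)) (sym (*-distribˡ-+ c (f x) (∑ xs f)))

∑-*ʳ : ∀ (xs : List A) c (f : A → ℕ) → ∑ xs (λ x → f x * c) ≡ ∑ xs f * c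
∑-*ʳ xs c f = trans (∑-cong xs (λ x → *-comm (f x) c)) (trans (∑-*ˡ xs c f) (*-comm c (∑ xs f)))

∑-const : ∀ (xs : List A) c → ∑ xs (λ _ → c) ≡ length xs * c
∑-const []       c = refl
∑-const (x ∷ xs) c = cong (c +_) (∑-const xs c)

∑-zero : ∀ (xs : List A) → ∑ xs (λ _ → 0) ≡ 0
∑-zero xs = trans (∑-const xs 0) (*-zeroʳ (length xs))

∑-swap : ∀ (xs : List A) (ys : List B) (f : A → B → ℕ) →
         ∑ xs (λ x → ∑ ys (f x)) ≡ ∑ ys (λ y → ∑ xs (λ x → f x y))
∑-swap []       ys f = sym (∑-zero ys)
∑-swap (x ∷ xs) ys f = trans (cong (∑ ys (f x) +_) (∑-swap xs ys f)) (sym (∑-+ ys (f x) _))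

∑-cartesianProductWith : ∀ (g : A → B → C) (xs : List A) (ys : List B) (f : C → ℕ) →
                         ∑ (cartesianProductWith g xs ys) f ≡ ∑ xs (λ x → ∑ ys (λ y → f (g x y)))
∑-cartesianProductWith g []       ys f = refl
∑-cartesianProductWith g (x ∷ xs) ys f = begin
  sum (map f (map (g x) ys ++ zs))              ≡⟨ cong sum (map-++ f (map (g x) ys) zs) ⟩
  sum (map f (map (g x) ys) ++ map f zs)        ≡⟨ sum-++ (map f (map (g x) ys)) (map f zs) ⟩
  sum (map f (map (g x) ys)) + ∑ zs f           ≡⟨ cong₂ _+_ (cong sum (sym (map-∘ ys))) (∑-cartesianProductWith g xs ys f) ⟩
  ∑ ys (λ y → f (g x y)) + ∑ xs (λ x → ∑ ys (λ y → f (g x y))) ∎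
  where
  open ≡-Reasoning
  zs = cartesianProductWith g xs ys

term≤∑ : ∀ {xs : List A} {x} (f : A → ℕ) → x ∈ xs → f x ≤ ∑ xs f
term≤∑ f (here refl) = m≤m+n _ _
term≤∑ f (there x∈)  = ≤-trans (term≤∑ f x∈) (m≤n+m _ _)

-- Letters, the grid [0,q)^k, and exponential weights on it.

bit : Bool → ℕ
bit b = if b then 1 else 0

trues falses : Sym k → ℕ
trues  = Vec.sum ∘ Vec.map bit
falses = Vec.sum ∘ Vec.map (bit ∘ not)

trues+falses : (a : Sym k) → trues a + falses a ≡ k
trues+falses []           = refl
trues+falses (true  ∷ a) = cong suc (trues+falses a)
trues+falses (false ∷ a) = trans (+-suc _ _) (cong suc (trues+falses a))

differs : Vec ℕ k → Vec ℕ k → Sym k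
differs = zipWith (λ m a → not ⌊ m ≟ a ⌋)

grid : ℕ → (k : ℕ) → List (Vec ℕ k)
grid q zero    = [] ∷ []
grid q (suc k) = cartesianProductWith _∷_ (downFrom q) (grid q k)

∈-grid⇒< : ∀ q {s : Vec ℕ k} → s ∈ grid q k → ∀ j → lookup s j < q
∈-grid⇒< {k = suc k} q s∈ j with ∈-cartesianProductWith⁻ _∷_ (downFrom q) (grid q k) s∈
∈-grid⇒< {k = suc k} q s∈ Fin.zero    | a , s , a∈ , s∈′ , refl = ∈-downFrom⁻ a∈
∈-grid⇒< {k = suc k} q s∈ (Fin.suc j) | a , s , a∈ , s∈′ , refl = ∈-grid⇒< q s∈′ j

∑-grid-const : ∀ q k c → ∑ (grid q k) (λ _ → c) ≡ q ^ k * c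
∑-grid-const q zero    c = refl
∑-grid-const q (suc k) c = begin
  ∑ (grid q (suc k)) (λ _ → c)                 ≡⟨ ∑-cartesianProductWith _∷_ (downFrom q) (grid q k) _ ⟩
  ∑ (downFrom q) (λ _ → ∑ (grid q k) (λ _ → c)) ≡⟨ ∑-const (downFrom q) _ ⟩
  length (downFrom q) * ∑ (grid q k) (λ _ → c) ≡⟨ cong₂ _*_ (length-downFrom q) (∑-grid-const q k c) ⟩
  q * (q ^ k * c)                              ≡⟨ *-assoc q (q ^ k) c ⟨
  q ^ suc k * c                                ∎
  where open ≡-Reasoning

-- Only `a = m` can weigh `M`; every other value weighs 1. The double negation is the form in which
-- `falses` reads a bit of `differs`.
∑-coordinate-weight : ∀ M m q → ∑ (downFrom q) (λ a → M ^ bit (not (not ⌊ m ≟ a ⌋))) ≤ M + q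
∑-coordinate-weight M m zero    = z≤n
∑-coordinate-weight M m (suc q) with m ≟ q
... | no  _    = ≤-trans (s≤s (∑-coordinate-weight M m q)) (≤-reflexive (sym (+-suc M q)))
-- The list descends, so after `m` only values below `m` remain, and each of them weighs 1.
... | yes refl = +-mono-≤ (≤-reflexive (^-identityʳ M)) (≤-trans (beyond m ≤-refl) (n≤1+n m))
  where
  beyond : ∀ r → r ≤ m → ∑ (downFrom r) (λ a → M ^ bit (not (not ⌊ m ≟ a ⌋))) ≤ r
  beyond zero    r≤m = z≤n
  beyond (suc r) r≤m with m ≟ r
  ... | yes refl = contradiction r≤m 1+n≰n
  ... | no  _    = s≤s (beyond r (<⇒≤ r≤m))

-- The weight is a product over the coordinates, so its sum over the grid factors into
-- one-coordinate sums.
∑-weight : ∀ M q (m : Vec ℕ k) → ∑ (grid q k) (λ s → M ^ falses (differs m s)) ≤ (M + q) ^ k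
∑-weight         M q []       = ≤-refl
∑-weight {suc k} M q (m ∷ ms) = begin
  ∑ (grid q (suc k)) (λ s → M ^ falses (differs (m ∷ ms) s))
    ≡⟨ ∑-cartesianProductWith _∷_ (downFrom q) (grid q k) _ ⟩
  ∑ (downFrom q) (λ a → ∑ (grid q k) (λ s → M ^ (e a + falses (differs ms s))))
    ≡⟨ ∑-cong (downFrom q) (λ a → trans (∑-cong (grid q k) (λ s → ^-distribˡ-+-* M (e a) _)) (∑-*ˡ (grid q k) (M ^ e a) _)) ⟩
  ∑ (downFrom q) (λ a → M ^ e a * W)
    ≡⟨ ∑-*ʳ (downFrom q) W _ ⟩
  ∑ (downFrom q) (λ a → M ^ e a) * W
    ≤⟨ *-mono-≤ (∑-coordinate-weight M m q) (∑-weight M q ms) ⟩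
  (M + q) ^ suc k ∎
  where
  open ≤-Reasoning
  e : ℕ → ℕ
  e a = bit (not (not ⌊ m ≟ a ⌋))
  W : ℕ
  W = ∑ (grid q k) (λ s → M ^ falses (differs ms s))

-- Bounding the term for `c = v s` by the sum over all `c` decouples the reference vector from `s`;
-- after swapping the sums, each vertex `c` has a fixed vector `m c`.
∑-weight-partition : ∀ {N} M q (v : Vec ℕ k → Fin N) (m : Fin N → Vec ℕ k) →
  ∑ (grid q k) (λ s → M ^ falses (differs (m (v s)) s)) ≤ N * (M + q) ^ k
∑-weight-partition {k} {N} M q v m = begin
  ∑ (grid q k) (λ s → f (v s) s)
    ≤⟨ ∑-mono (grid q k) (λ {s} _ → term≤∑ (λ c → f c s) (∈-allFin (v s))) ⟩
  ∑ (grid q k) (λ s → ∑ (allFin N) (λ c → f c s))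
    ≡⟨ ∑-swap (grid q k) (allFin N) _ ⟩
  ∑ (allFin N) (λ c → ∑ (grid q k) (f c))
    ≤⟨ ∑-mono (allFin N) (λ {c} _ → ∑-weight M q (m c)) ⟩
  ∑ (allFin N) (λ _ → (M + q) ^ k)
    ≡⟨ trans (∑-const (allFin N) _) (cong (_* (M + q) ^ k) (length-tabulate {n = N} id)) ⟩
  N * (M + q) ^ k ∎
  where
  open ≤-Reasoning
  f : Fin N → Vec ℕ k → ℕ
  f c s = M ^ falses (differs (m c) s)

-- Coordinatewise minima over the grid points that share a vertex.

module _ {N} (q : ℕ) (v : Vec ℕ k → Fin N) where

  fibre : Fin N → List (Vec ℕ k)
  fibre c = filter (λ t → v t Fin.≟ c) (grid q k)

  -- On an empty fibre this is the junk vector (q, …, q), outside the grid.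
  minimiser : Fin N → Fin k → Vec ℕ k
  minimiser c j = argmin (λ t → lookup t j) (replicate k q) (fibre c)

  -- The vector μ(c). Its entries may be attained at different grid points, so it need not lie in
  -- the fibre itself.
  fibreMin : Fin N → Vec ℕ k
  fibreMin c = tabulate λ j → lookup (minimiser c j) j

  fibreMin≤ : ∀ {s} → s ∈ grid q k → ∀ j → lookup (fibreMin (v s)) j ≤ lookup s j
  fibreMin≤ {s} s∈ j rewrite lookup∘tabulate (λ j → lookup (minimiser (v s) j) j) j =
    All.lookup (f[argmin]≤f[xs] {f = λ t → lookup t j} (replicate k q) (fibre (v s))) (∈-filter⁺ (λ t → v t Fin.≟ v s) s∈ refl)

  fibreMin-attained : ∀ {s} → s ∈ grid q k → ∀ j →
    ∃ λ t → t ∈ grid q k × v t ≡ v s × lookup t j ≡ lookup (fibreMin (v s)) j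
  fibreMin-attained {s} s∈ j with argmin-sel (λ t → lookup t j) (replicate k q) (fibre (v s))
  ... | inj₂ t∈ with ∈-filter⁻ (λ t → v t Fin.≟ v s) {xs = grid q k} t∈
  ...   | t∈grid , vt≡vs = _ , t∈grid , vt≡vs , sym (lookup∘tabulate _ j)
  -- The default has entry `q`, but `s` lies in its own fibre, so the minimum is at most
  -- `lookup s j`, which is below `q`.
  fibreMin-attained {s} s∈ j | inj₁ default = contradiction (∈-grid⇒< q s∈ j) (≤⇒≯ (begin
    q                                  ≡⟨ lookup-replicate j q ⟨
    lookup (replicate k q) j           ≡⟨ cong (λ t → lookup t j) default ⟨
    lookup (minimiser (v s) j) j       ≡⟨ lookup∘tabulate _ j ⟨
    lookup (fibreMin (v s)) j          ≤⟨ fibreMin≤ s∈ j ⟩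
    lookup s j                         ∎))
    where open ≤-Reasoning

-- Trading a number of zeros for an exponential weight.

falses≤ : (a : Sym k) → falses a ≤ k
falses≤ a = ≤-trans (m≤n+m _ (trues a)) (≤-reflexive (trues+falses a))

^-distribʳ-* : ∀ k m n → (m * n) ^ k ≡ m ^ k * n ^ k
^-distribʳ-* zero    m n = refl
^-distribʳ-* (suc k) m n = trans (cong (m * n *_) (^-distribʳ-* k m n)) (interchange *-commutativeSemigroup m n _ _)

-- Markov's inequality: if 8b > k then A^k ≤ (A^8)^b.
8b*A^k≤ : ∀ {A b} → A > 0 → b ≤ k → 8 * A ^ k * b ≤ k * A ^ k + 8 * k * (A ^ 8) ^ b
8b*A^k≤ {k} {A} {b} A>0 b≤k with 8 * b ≤? k
... | yes 8b≤k = begin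
  8 * A ^ k * b     ≡⟨ e (A ^ k) b ⟩
  8 * b * A ^ k     ≤⟨ *-monoˡ-≤ (A ^ k) 8b≤k ⟩
  k * A ^ k         ≤⟨ m≤m+n _ _ ⟩
  k * A ^ k + 8 * k * (A ^ 8) ^ b ∎
  where
  open ≤-Reasoning
  e : ∀ x b → 8 * x * b ≡ 8 * b * x
  e = solve-∀
... | no 8b≰k = begin
  8 * A ^ k * b             ≤⟨ *-mono-≤ (*-monoʳ-≤ 8 (^-monoʳ-≤ A ⦃ >-nonZero A>0 ⦄ (<⇒≤ (≰⇒> 8b≰k)))) b≤k ⟩
  8 * A ^ (8 * b) * k       ≡⟨ cong (λ z → 8 * z * k) (^-*-assoc A 8 b) ⟨
  8 * (A ^ 8) ^ b * k       ≡⟨ e ((A ^ 8) ^ b) k ⟩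
  8 * k * (A ^ 8) ^ b       ≤⟨ m≤n+m _ _ ⟩
  k * A ^ k + 8 * k * (A ^ 8) ^ b ∎
  where
  open ≤-Reasoning
  e : ∀ x b → 8 * x * b ≡ 8 * b * x
  e = solve-∀

-- Extending inputs and counting ones.

snoc : ∀ {i} → Input k i → Sym k → Input k (suc i)
snoc {i = zero}  x a _           = a
snoc {i = suc i} x a Fin.zero    = x Fin.zero
snoc {i = suc i} x a (Fin.suc f) = snoc (x ∘ Fin.suc) a f

snoc-inject₁ : ∀ {i} (x : Input k i) a f → snoc x a (inject₁ f) ≡ x f
snoc-inject₁ {i = suc i} x a Fin.zero    = refl
snoc-inject₁ {i = suc i} x a (Fin.suc f) = snoc-inject₁ (x ∘ Fin.suc) a f

snoc-fromℕ : ∀ {i} (x : Input k i) a → snoc x a (fromℕ i) ≡ a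
snoc-fromℕ {i = zero}  x a = refl
snoc-fromℕ {i = suc i} x a = snoc-fromℕ (x ∘ Fin.suc) a

-- The prefix recovered from `snoc x a` agrees with `x` only pointwise; this lemma and `run-cong`
-- carry such agreement over to counts and vertices.
count-cong : ∀ {i} {x y : Input k i} → (∀ f → x f ≡ y f) → ∀ j → count x j ≡ count y j
count-cong {i = zero}  x≗y j = refl
count-cong {i = suc i} x≗y j =
  cong₂ _+_ (cong (λ a → bit (lookup a j)) (x≗y (fromℕ i))) (count-cong (x≗y ∘ inject₁) j)

count-constant : ∀ i b (j : Fin k) → count {m = i} (λ _ → replicate k b) j ≡ i * bit b
count-constant zero    b j = refl
count-constant (suc i) b j = cong₂ _+_ (cong bit (lookup-replicate j b)) (count-constant i b j)

sum-zipWith-bit : (a : Sym k) (h : Vec ℕ k) → Vec.sum (zipWith (λ b m → bit b + m) a h) ≡ trues a + Vec.sum h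
sum-zipWith-bit []      []      = refl
sum-zipWith-bit (b ∷ a) (m ∷ h) =
  trans (cong (bit b + m +_) (sum-zipWith-bit a h)) (interchange +-commutativeSemigroup (bit b) m _ _)

sum≤ : ∀ c B (h : Vec ℕ k) → (∀ j → c * lookup h j ≤ B) → c * Vec.sum h ≤ k * B
sum≤ c B []      h≤B = ≤-reflexive (*-zeroʳ c)
sum≤ c B (m ∷ h) h≤B = ≤-trans (≤-reflexive (*-distribˡ-+ c m (Vec.sum h)))
                                (+-mono-≤ (h≤B Fin.zero) (sum≤ c B h (h≤B ∘ Fin.suc)))

-- The adversary and its invariant.

module _ (P : ROBP n k) where
  open ROBP P

  run-cong : ∀ i {x y : Input k i} → (∀ f → x f ≡ y f) → run i x ≡ run i y
  run-cong zero    x≗y = refl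
  run-cong (suc i) x≗y = cong₂ (step i) (run-cong i (x≗y ∘ inject₁)) (x≗y (fromℕ i))

  -- One coordinate at a time: the witnessing input may vary with `j`.
  Reaches : ∀ i → Fin (size i) → Fin k → ℕ → Set
  Reaches i c j m = ∃ λ x → run i x ≡ c × count x j ≡ m

  Reaches-step : ∀ {i c j m} → Reaches i c j m → ∀ a → Reaches (suc i) (step i c a) j (bit (lookup a j) + m)
  Reaches-step {i} {j = j} (x , refl , refl) a =
    snoc x a ,
    cong₂ (step i) (run-cong i (snoc-inject₁ x a)) (snoc-fromℕ x a) ,
    cong₂ _+_ (cong (λ a → bit (lookup a j)) (snoc-fromℕ x a)) (count-cong (snoc-inject₁ x a) j)

  -- Two inputs ending at the same vertex receive the same output, which is within n/3 of both
  -- counts.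
  Reaches-gap : ComputesApproxCount P → ∀ {c j m m′} → Reaches n c j m → Reaches n c j m′ → 3 * m′ ≤ 3 * m + 2 * n
  Reaches-gap comp {j = j} (x , refl , refl) (y , y↦c , refl) =
    close⇒3*≤ (lookup (eval x) j) n (count x j) (count y j) (comp x j)
      (subst (λ o → ∣ lookup o j - (ℤ.+ count y j) /ℚ 1 ∣ ≤ℚ (ℤ.+ n) /ℚ 3) (cong out y↦c) (comp y j))

  module _ (q : ℕ) where

    -- All grid points advance together: the letter for `s` depends, through the fibre minima, on
    -- the vertices currently occupied by all the others.
    mutual
      vertex : ∀ i → Vec ℕ k → Fin (size i)
      vertex zero    s = start
      vertex (suc i) s = step i (vertex i s) (letter i s)

      letter : ∀ i → Vec ℕ k → Sym k
      letter i s = differs (fibreMin q (vertex i) (vertex i s)) s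

    ones : ℕ → Vec ℕ k → Vec ℕ k
    ones zero    s = replicate k 0
    ones (suc i) s = zipWith (λ b m → bit b + m) (letter i s) (ones i s)

    zeros : ℕ → Vec ℕ k → ℕ
    zeros zero    s = 0
    zeros (suc i) s = falses (letter i s) + zeros i s

    ones+zeros : ∀ i s → Vec.sum (ones i s) + zeros i s ≡ i * k
    ones+zeros zero    s = trans (+-identityʳ _) (sum-zero k)
      where
      sum-zero : ∀ k → Vec.sum (replicate k 0) ≡ 0
      sum-zero zero    = refl
      sum-zero (suc k) = sum-zero k
    ones+zeros (suc i) s = begin
      Vec.sum (ones (suc i) s) + zeros (suc i) s
        ≡⟨ cong (_+ zeros (suc i) s) (sum-zipWith-bit (letter i s) (ones i s)) ⟩
      trues (letter i s) + Vec.sum (ones i s) + (falses (letter i s) + zeros i s)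
        ≡⟨ interchange +-commutativeSemigroup (trues (letter i s)) (Vec.sum (ones i s)) (falses (letter i s)) (zeros i s) ⟩
      trues (letter i s) + falses (letter i s) + (Vec.sum (ones i s) + zeros i s)
        ≡⟨ cong₂ _+_ (trues+falses (letter i s)) (ones+zeros i s) ⟩
      suc i * k ∎
      where
      open ≡-Reasoning

    -- The witness is the adversary's own input for `s`.
    Reaches-high : ∀ i s j → Reaches i (vertex i s) j (lookup (ones i s) j)
    Reaches-high zero    s j = (λ ()) , refl , sym (lookup-replicate j 0)
    Reaches-high (suc i) s j rewrite lookup-zipWith (λ b m → bit b + m) j (letter i s) (ones i s) =
      Reaches-step (Reaches-high i s j) (letter i s)

    -- On a bit 0 the old witness is extended without a new one. On a bit 1 it is exchanged for the
    -- witness of a point `t` at the same vertex with minimal `j`-th entry.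
    Reaches-low : ∀ i {s} → s ∈ grid q k → ∀ j → ∃ λ m → m ≤ lookup s j × Reaches i (vertex i s) j m
    Reaches-low zero    s∈ j = 0 , z≤n , (λ ()) , refl , refl
    Reaches-low (suc i) {s} s∈ j
      with lookup (fibreMin q (vertex i) (vertex i s)) j ≟ lookup s j
         | lookup-zipWith (λ m a → not ⌊ m ≟ a ⌋) j (fibreMin q (vertex i) (vertex i s)) s
    ... | yes _ | letter≡0 with Reaches-low i s∈ j
    ...   | m , m≤ , r = m , m≤ , subst (λ b → Reaches (suc i) _ j (bit b + m)) letter≡0 (Reaches-step r (letter i s))
    Reaches-low (suc i) {s} s∈ j | no μ≢s | letter≡1 with fibreMin-attained q (vertex i) s∈ j
    ... | t , t∈ , same , t≡μ with Reaches-low i t∈ j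
    ...   | m , m≤ , r =
      -- Here `m` is at most t_j = μ_j and μ_j < s_j, which leaves room for the appended one.
      suc m ,
      ≤-<-trans (≤-trans m≤ (≤-reflexive t≡μ)) (≤∧≢⇒< (fibreMin≤ q (vertex i) s∈ j) μ≢s) ,
      subst (λ b → Reaches (suc i) _ j (bit b + m)) letter≡1
        (Reaches-step (subst (λ c → Reaches i c j m) same r) (letter i s))

    -- Each coordinate receives at most q + 2n/3 ones, and q ≤ n/12 makes this at most 3n/4.
    zeros≥quarter : ComputesApproxCount P → 12 * q ≤ n → ∀ {s} → s ∈ grid q k → n * k ≤ 4 * zeros n s
    zeros≥quarter comp 12q≤n {s} s∈ = *-cancelˡ-≤ 3 (+-cancelʳ-≤ (9 * (n * k)) _ _ (begin
      -- The factor 12 clears the denominators 3 and 4; carrying 9nk on both sides avoids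
      -- subtraction.
      3 * (n * k) + 9 * (n * k)                  ≡⟨ e₁ (n * k) ⟩
      12 * (n * k)                               ≡⟨ cong (12 *_) (ones+zeros n s) ⟨
      12 * (H + Z)                               ≡⟨ e₂ H Z ⟩
      4 * (3 * H) + 12 * Z                       ≤⟨ +-monoˡ-≤ (12 * Z) (*-monoʳ-≤ 4 (sum≤ 3 (3 * q + 2 * n) (ones n s) high≤)) ⟩
      4 * (k * (3 * q + 2 * n)) + 12 * Z         ≡⟨ e₃ k q n Z ⟩
      (12 * q) * k + 8 * (n * k) + 12 * Z        ≤⟨ +-monoˡ-≤ (12 * Z) (+-monoˡ-≤ (8 * (n * k)) (*-monoˡ-≤ k 12q≤n)) ⟩
      n * k + 8 * (n * k) + 12 * Z               ≡⟨ e₄ (n * k) Z ⟩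
      3 * (4 * Z) + 9 * (n * k)                  ∎))
      where
      open ≤-Reasoning
      H = Vec.sum (ones n s)
      Z = zeros n s
      high≤ : ∀ j → 3 * lookup (ones n s) j ≤ 3 * q + 2 * n
      high≤ j with Reaches-low n s∈ j
      ... | m , m≤ , r = ≤-trans (Reaches-gap comp r (Reaches-high n s j))
        (+-monoˡ-≤ (2 * n) (*-monoʳ-≤ 3 (≤-trans m≤ (<⇒≤ (∈-grid⇒< q s∈ j)))))
      e₁ : ∀ x → 3 * x + 9 * x ≡ 12 * x
      e₁ = solve-∀
      e₂ : ∀ h z → 12 * (h + z) ≡ 4 * (3 * h) + 12 * z
      e₂ = solve-∀
      e₃ : ∀ k q n z → 4 * (k * (3 * q + 2 * n)) + 12 * z ≡ (12 * q) * k + 8 * (n * k) + 12 * z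
      e₃ = solve-∀
      e₄ : ∀ x z → x + 8 * x + 12 * z ≡ 3 * (4 * z) + 9 * x
      e₄ = solve-∀

  -- Upper bound on the zeros fed, and the resulting width bound.

  module _ {w A : ℕ} (A>0 : A > 0) (width : ∀ i → i ≤ n → size i ≤ w) where

    q = A ^ 8

    -- The inequality `8b*A^k≤` is applied to each letter and summed over the grid. The weight base
    -- is taken equal to `q`, so each coordinate sum is at most `q + q`.
    layer-zeros : ∀ i → i ≤ n →
      8 * A ^ k * ∑ (grid q k) (λ s → falses (letter q i s)) ≤ k * A ^ k * q ^ k + 8 * k * (w * (q + q) ^ k)
    layer-zeros i i≤n = begin
      8 * A ^ k * ∑ (grid q k) (λ s → falses (letter q i s))
        ≡⟨ ∑-*ˡ (grid q k) (8 * A ^ k) _ ⟨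
      ∑ (grid q k) (λ s → 8 * A ^ k * falses (letter q i s))
        ≤⟨ ∑-mono (grid q k) (λ {s} _ → 8b*A^k≤ A>0 (falses≤ (letter q i s))) ⟩
      ∑ (grid q k) (λ s → k * A ^ k + 8 * k * q ^ falses (letter q i s))
        ≡⟨ ∑-+ (grid q k) _ _ ⟩
      ∑ (grid q k) (λ _ → k * A ^ k) + ∑ (grid q k) (λ s → 8 * k * q ^ falses (letter q i s))
        ≡⟨ cong₂ _+_ (trans (∑-grid-const q k (k * A ^ k)) (*-comm (q ^ k) _)) (∑-*ˡ (grid q k) (8 * k) _) ⟩
      k * A ^ k * q ^ k + 8 * k * ∑ (grid q k) (λ s → q ^ falses (letter q i s))
        ≤⟨ +-monoʳ-≤ _ (*-monoʳ-≤ (8 * k) (∑-weight-partition q q (vertex q i) (fibreMin q (vertex q i)))) ⟩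
      k * A ^ k * q ^ k + 8 * k * (size i * (q + q) ^ k)
        ≤⟨ +-monoʳ-≤ _ (*-monoʳ-≤ (8 * k) (*-monoˡ-≤ ((q + q) ^ k) (width i i≤n))) ⟩
      k * A ^ k * q ^ k + 8 * k * (w * (q + q) ^ k) ∎
      where open ≤-Reasoning

    total-zeros : ∀ i → i ≤ n →
      8 * A ^ k * ∑ (grid q k) (zeros q i) ≤ i * (k * A ^ k * q ^ k + 8 * k * (w * (q + q) ^ k))
    total-zeros zero    _   = ≤-reflexive (trans (cong (8 * A ^ k *_) (∑-zero (grid q k))) (*-zeroʳ (8 * A ^ k)))
    total-zeros (suc i) i<n = begin
      8 * A ^ k * ∑ (grid q k) (λ s → falses (letter q i s) + zeros q i s)
        ≡⟨ cong (8 * A ^ k *_) (∑-+ (grid q k) _ _) ⟩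
      8 * A ^ k * (∑ (grid q k) (λ s → falses (letter q i s)) + ∑ (grid q k) (zeros q i))
        ≡⟨ *-distribˡ-+ (8 * A ^ k) _ _ ⟩
      8 * A ^ k * ∑ (grid q k) (λ s → falses (letter q i s)) + 8 * A ^ k * ∑ (grid q k) (zeros q i)
        ≤⟨ +-mono-≤ (layer-zeros i (<⇒≤ i<n)) (total-zeros i (<⇒≤ i<n)) ⟩
      suc i * (k * A ^ k * q ^ k + 8 * k * (w * (q + q) ^ k)) ∎
      where open ≤-Reasoning

    A^k≤8w2^k : ComputesApproxCount P → k > 0 → 12 * q ≤ n → A ^ k ≤ 8 * w * 2 ^ k
    A^k≤8w2^k comp k>0 12q≤n =
      -- After scaling, the quarter of zeros gives 2A^k on the left, while letters with at most k/8
      -- zeros account for at most A^k on the right. The threshold 1/8 is half of 1/4, so one A^k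
      -- survives the cancellation.
      +-cancelˡ-≤ (A ^ k) _ _ (*-cancelˡ-≤ (n * k * q ^ k) ⦃ >-nonZero scale>0 ⦄ (begin
      n * k * q ^ k * (A ^ k + A ^ k)
        ≡⟨ e₁ (n * k) (q ^ k) (A ^ k) ⟩
      2 * A ^ k * (q ^ k * (n * k))
        ≡⟨ cong (2 * A ^ k *_) (∑-grid-const q k (n * k)) ⟨
      2 * A ^ k * ∑ (grid q k) (λ _ → n * k)
        ≤⟨ *-monoʳ-≤ (2 * A ^ k) (∑-mono (grid q k) (zeros≥quarter q comp 12q≤n)) ⟩
      2 * A ^ k * ∑ (grid q k) (λ s → 4 * zeros q n s)
        ≡⟨ cong (2 * A ^ k *_) (∑-*ˡ (grid q k) 4 _) ⟩
      2 * A ^ k * (4 * ∑ (grid q k) (zeros q n))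
        ≡⟨ e₂ (A ^ k) _ ⟩
      8 * A ^ k * ∑ (grid q k) (zeros q n)
        ≤⟨ total-zeros n ≤-refl ⟩
      n * (k * A ^ k * q ^ k + 8 * k * (w * (q + q) ^ k))
        ≡⟨ cong (λ z → n * (k * A ^ k * q ^ k + 8 * k * (w * z))) (trans (cong (_^ k) (e₃ q)) (^-distribʳ-* k 2 q)) ⟩
      n * (k * A ^ k * q ^ k + 8 * k * (w * (2 ^ k * q ^ k)))
        ≡⟨ e₄ n k (A ^ k) (q ^ k) w (2 ^ k) ⟩
      n * k * q ^ k * (A ^ k + 8 * w * 2 ^ k) ∎))
      where
      open ≤-Reasoning
      q>0 : q > 0
      q>0 = m^n>0 A ⦃ >-nonZero A>0 ⦄ 8
      scale>0 : n * k * q ^ k > 0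
      scale>0 = *-mono-≤ (*-mono-≤ (≤-trans q>0 (≤-trans (m≤n*m q 12) 12q≤n)) k>0) (m^n>0 q ⦃ >-nonZero q>0 ⦄ k)
      e₁ : ∀ x y z → x * y * (z + z) ≡ 2 * z * (y * x)
      e₁ = solve-∀
      e₂ : ∀ x y → 2 * x * (4 * y) ≡ 8 * x * y
      e₂ = solve-∀
      e₃ : ∀ x → x + x ≡ 2 * x
      e₃ = solve-∀
      e₄ : ∀ n k a q w t → n * (k * a * q + 8 * k * (w * (t * q))) ≡ n * k * q * (a + 8 * w * t)
      e₄ = solve-∀

  -- With a single final vertex the all-zero and all-one inputs would share an output, although
  -- their counts differ by n > 2n/3.
  width≥2 : ComputesApproxCount P → k > 0 → n > 0 → ∀ {w} → size n ≤ w → 2 ≤ w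
  width≥2 comp k>0 n>0 {w} size≤w with 2 ≤? w
  ... | yes 2≤w = 2≤w
  ... | no  2≰w = contradiction (+-cancelʳ-≤ (2 * n) n 0 (≤-trans (≤-reflexive (e n)) gap)) (<⇒≱ n>0)
    where
    j : Fin k
    j = Fin.fromℕ< k>0
    single : (c d : Fin (size n)) → c ≡ d
    single c d = Fin.toℕ-injective (trans (to0 c) (sym (to0 d)))
      where
      to0 : ∀ c → Fin.toℕ c ≡ 0
      to0 c = n<1⇒n≡0 (<-≤-trans (Fin.toℕ<n c) (≤-trans size≤w (≤-pred (≰⇒> 2≰w))))
    constant : ∀ b → Input k n
    constant b _ = replicate k b
    gap : 3 * n ≤ 0 + 2 * n
    gap = Reaches-gap comp {c = run n (constant false)}
      (constant false , refl , trans (count-constant n false j) (*-zeroʳ n))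
      (constant true  , single _ _ , trans (count-constant n true j) (*-identityʳ n))
    e : ∀ x → x + 2 * x ≡ 3 * x
    e = solve-∀

-- Choice of the parameter `b` and comparison of exponents.

-- Discrete intermediate value by descent from `b`: the first `m` met with `f m ≤ n` still has
-- `n < f (suc m)`.
crossing : ∀ (f : ℕ → ℕ) a {n} b → f a ≤ n → n < f b → a ≤ b → ∃ λ m → a ≤ m × f m ≤ n × n < f (suc m)
crossing f a zero    fa≤n n<fb z≤n = contradiction n<fb (≤⇒≯ fa≤n)
crossing f a {n} (suc b) fa≤n n<fb a≤b with f b ≤? n
... | no  fb≰n = crossing f a b fa≤n (≰⇒> fb≰n) (≤-pred (≤∧≢⇒< a≤b (λ { refl → contradiction n<fb (≤⇒≯ fa≤n) })))
... | yes fb≤n = b , ≤-pred (≤∧≢⇒< a≤b (λ { refl → contradiction n<fb (≤⇒≯ fa≤n) })) , fb≤n , n<fb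

-- Opaque because unification otherwise unfolds the eighth power and runs out of memory.
opaque
  scale : ℕ → ℕ
  scale b = 12 * (16 * b) ^ 8

  scale-≡ : ∀ b → scale b ≡ 12 * (16 * b) ^ 8
  scale-≡ b = refl

  n<scale : ∀ n → n < scale (suc n)
  n<scale n = begin-strict
    n                              <⟨ n<1+n n ⟩
    suc n                          ≤⟨ m≤n*m (suc n) 16 ⟩
    16 * suc n                     ≤⟨ m≤m*n (16 * suc n) ((16 * suc n) ^ 7) ⦃ m^n≢0 (16 * suc n) 7 ⦄ ⟩
    (16 * suc n) ^ 8               ≤⟨ m≤n*m _ 12 ⟩
    scale (suc n)                  ∎
    where open ≤-Reasoning

  -- For b ≥ 2 both 12 and 16 are at most b^4, and b + 1 is at most b^2; hence the exponent 4 + 8(4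
  -- + 2) = 52.
  scale≤^ : ∀ {b} → 2 ≤ b → scale (suc b) ≤ b ^ 52
  scale≤^ {b} 2≤b = begin
    12 * (16 * suc b) ^ 8          ≤⟨ *-mono-≤ 12≤ (^-monoˡ-≤ 8 (*-mono-≤ 16≤ suc≤)) ⟩
    b ^ 4 * (b ^ 4 * b ^ 2) ^ 8    ≡⟨ cong (λ z → b ^ 4 * z ^ 8) (^-distribˡ-+-* b 4 2) ⟨
    b ^ 4 * (b ^ 6) ^ 8            ≡⟨ cong (b ^ 4 *_) (^-*-assoc b 6 8) ⟩
    b ^ 4 * b ^ 48                 ≡⟨ ^-distribˡ-+-* b 4 48 ⟨
    b ^ 52                         ∎
    where
    open ≤-Reasoning
    16≤ : 16 ≤ b ^ 4
    16≤ = ^-monoˡ-≤ 4 2≤b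
    12≤ : 12 ≤ b ^ 4
    12≤ = ≤-trans (m≤m+n 12 4) 16≤
    suc≤ : suc b ≤ b ^ 2
    suc≤ = begin
      1 + b      ≤⟨ +-monoˡ-≤ b (<⇒≤ 2≤b) ⟩
      b + b      ≡⟨ cong (b +_) (+-identityʳ b) ⟨
      2 * b      ≤⟨ *-monoˡ-≤ b 2≤b ⟩
      b * b      ≡⟨ cong (b *_) (*-identityʳ b) ⟨
      b ^ 2      ∎

exchange-exponents : ∀ e b k n w → n ≤ b ^ e → b ^ k ≤ w → n ^ k ≤ w ^ e
exchange-exponents e b k n w n≤b^e b^k≤w = begin
  n ^ k            ≤⟨ ^-monoˡ-≤ k n≤b^e ⟩
  (b ^ e) ^ k      ≡⟨ ^-*-assoc b e k ⟩
  b ^ (e * k)      ≡⟨ cong (b ^_) (*-comm e k) ⟩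
  b ^ (k * e)      ≡⟨ ^-*-assoc b k e ⟨
  (b ^ k) ^ e      ≤⟨ ^-monoˡ-≤ e b^k≤w ⟩
  w ^ e            ∎
  where open ≤-Reasoning

module _ {n k w : ℕ} (P : ROBP n k) (comp : ComputesApproxCount P) (k>0 : k > 0) (n>0 : n > 0)
         (width : ∀ i → i ≤ n → ROBP.size P i ≤ w) where

  power≤width : ∀ {b} → b > 0 → scale b ≤ n → b ^ k ≤ w
  power≤width {b} b>0 scale≤n = *-cancelˡ-≤ (16 ^ k) ⦃ m^n≢0 16 k ⦄ (begin
    16 ^ k * b ^ k        ≡⟨ ^-distribʳ-* k 16 b ⟨
    -- With A = 16b the surplus 8 · 2^k is absorbed by 16^k, since k ≥ 1.
    (16 * b) ^ k          ≤⟨ A^k≤8w2^k P (*-mono-≤ (s≤s {n = 15} z≤n) b>0) width comp k>0 (subst (_≤ n) (scale-≡ b) scale≤n) ⟩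
    8 * w * 2 ^ k         ≤⟨ *-monoˡ-≤ (2 ^ k) (*-monoˡ-≤ w 8≤) ⟩
    8 ^ k * w * 2 ^ k     ≡⟨ e (8 ^ k) w (2 ^ k) ⟩
    8 ^ k * 2 ^ k * w     ≡⟨ cong (_* w) (^-distribʳ-* k 8 2) ⟨
    16 ^ k * w            ∎)
    where
    open ≤-Reasoning
    8≤ : 8 ≤ 8 ^ k
    8≤ = ≤-trans (≤-reflexive (sym (^-identityʳ 8))) (^-monoʳ-≤ 8 k>0)
    e : ∀ x w y → x * w * y ≡ x * y * w
    e = solve-∀

  n^k≤w^52 : scale 2 ≤ n → n ^ k ≤ w ^ 52
  -- The `b` found satisfies scale b ≤ n < scale (b + 1), so b^k ≤ w while n is at most b^52.
  n^k≤w^52 scale2≤n with crossing scale 2 (suc n) scale2≤n (n<scale n) (s≤s n>0)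
  ... | b , 2≤b , scale≤n , n<scale′ =
    exchange-exponents 52 b k n w (≤-trans (<⇒≤ n<scale′) (scale≤^ 2≤b)) (power≤width (<⇒≤ 2≤b) scale≤n)

n<2^n : ∀ n → n < 2 ^ n
n<2^n zero    = s≤s z≤n
n<2^n (suc n) = begin-strict
  suc n          ≤⟨ n<2^n n ⟩
  2 ^ n          <⟨ m<n+m (2 ^ n) (m^n>0 2 n) ⟩
  2 ^ n + 2 ^ n  ≡⟨ cong (2 ^ n +_) (+-identityʳ (2 ^ n)) ⟨
  2 ^ suc n      ∎
  where open ≤-Reasoning

-- For n ≤ c the exponent k is also at most c, so n^k is bounded by the constant 2^(c*c), and w ≥ 2
-- supplies the base.
bounded-power≤ : ∀ {c n k w} → n > 0 → n ≤ c → k ≤ n → 2 ≤ w → n ^ k ≤ w ^ (c * c)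
bounded-power≤ {c} {n} {k} {w} n>0 n≤c k≤n 2≤w = begin
  n ^ k            ≤⟨ ^-monoʳ-≤ n ⦃ >-nonZero n>0 ⦄ (≤-trans k≤n n≤c) ⟩
  n ^ c            ≤⟨ ^-monoˡ-≤ c (≤-trans n≤c (<⇒≤ (n<2^n c))) ⟩
  (2 ^ c) ^ c      ≡⟨ ^-*-assoc 2 c c ⟩
  2 ^ (c * c)      ≤⟨ ^-monoˡ-≤ (c * c) 2≤w ⟩
  w ^ (c * c)      ∎
  where open ≤-Reasoning

-- Splits at the threshold `c`; the exponent 52 + c*c covers both the large and the bounded range of
-- `n`.
power≤ : ∀ c {n k w} → n > 0 → k ≤ n → 2 ≤ w → (c ≤ n → n ^ k ≤ w ^ 52) → n ^ (1 * k) ≤ w ^ (52 + c * c)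
power≤ c {n} {k} {w} n>0 k≤n 2≤w large with c ≤? n
... | yes c≤n = begin
  n ^ (1 * k)      ≡⟨ cong (n ^_) (*-identityˡ k) ⟩
  n ^ k            ≤⟨ large c≤n ⟩
  w ^ 52           ≤⟨ ^-monoʳ-≤ w ⦃ >-nonZero (<⇒≤ 2≤w) ⦄ (m≤m+n 52 (c * c)) ⟩
  w ^ (52 + c * c) ∎
  where open ≤-Reasoning
... | no  c≰n = begin
  n ^ (1 * k)      ≡⟨ cong (n ^_) (*-identityˡ k) ⟩
  n ^ k            ≤⟨ bounded-power≤ n>0 (<⇒≤ (≰⇒> c≰n)) k≤n 2≤w ⟩
  w ^ (c * c)      ≤⟨ ^-monoʳ-≤ w ⦃ >-nonZero (<⇒≤ 2≤w) ⦄ (m≤n+m (c * c) 52) ⟩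
  w ^ (52 + c * c) ∎
  where open ≤-Reasoning

theorem5p1 : Σ ℕ λ p → Σ ℕ λ q → p > 0 × q > 0 ×
    ((k n w : ℕ) → 1 ≤ k → 3 * k ≤ n → 1 ≤ w →
    (P : ROBP n k) → ROBP.Reachable P → ROBP.HasWidth P w → ComputesApproxCount P →
    n ^ (p * k) ≤ w ^ q)
-- The absolute constant is the rational p/q = 1/(52 + scale 2 * scale 2), with `scale 2` as the
-- threshold between bounded and large `n`; raising to the power q keeps the inequality in ℕ.
theorem5p1 = 1 , 52 + scale 2 * scale 2 , s≤s z≤n , s≤s z≤n ,
  λ k n w k>0 3k≤n _ P _ (width , _) comp →
    let k≤n = ≤-trans (m≤n*m k 3) 3k≤n
        n>0 = ≤-trans k>0 k≤n
    in power≤ (scale 2) n>0 k≤n (width≥2 P comp k>0 n>0 (width n ≤-refl)) (n^k≤w^52 P comp k>0 n>0 width)
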